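{- For any finite, simple, connected signed graph $\Sigma$ and any integer $k\ge 1$, $$\operatorname{bdim}(N_k[\Sigma])=\operatorname{bdim}(\Sigma[N_k])=\operatorname{bdim}(\Sigma),$$ where $N_k$ is the graph on $k$ vertices without edges and $\cdot[\cdot]$ denotes the HG-lexicographic product.
   Context: A signed graph $\Sigma=(G,\sigma)$ is a graph $G=(V,E)$ with a function $\sigma:E\to\{+1,-1\}$. All graphs are finite, simple, connected and undirected unless otherwise mentioned; $N_k$ (regarded as a signed graph with empty signature) and the product $N_k[\Sigma]$ may be disconnected. Let $\Omega=\{ -1,0,1\}$, with $\Omega^d\subset\mathbb{R}^d$ carrying the standard inner product $\langle\cdot,\cdot\rangle$. A vector valued switching function ($d$-switching function) for $\Sigma$ is a map $\zeta:V\to\Omega^d$ with $\langle\zeta(u),\zeta(v)\rangle\neq 0$ for every edge $uv\in E$; the switched signed graph $\Sigma^\zeta=(G,\sigma^\zeta)$ has $\sigma^\zeta(uv)=\sigma(uv)\operatorname{sgn}(\langle\zeta(u),\zeta(v)\rangle)$. The balancing dimension $\operatorname{bdim}(\Sigma)$ is the least integer $d\ge 1$ for which there is a $d$-switching function $\zeta:V\to\Omega^d$ such that $\Sigma^\zeta$ is all-positive (every edge has sign $+1$). The lexicographic product $G_1[G_2]$ of graphs has vertex set $V(G_1)\times V(G_2)$, with $(u_i,v_j)$ adjacent to $(u_k,v_l)$ iff $u_i\sim u_k$ in $G_1$, or $u_i=u_k$ and $v_j\sim v_l$ in $G_2$. The HG-lexicographic product $\Sigma_1[\Sigma_2]$ of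 $\Sigma_1=(G_1,\sigma_1)$ and $\Sigma_2=(G_2,\sigma_2)$ is the signed graph on $G_1[G_2]$ with signature $\sigma((u_i,v_j)(u_k,v_l))=\sigma_1(u_iu_k)$ if $i\ne k$, and $=\sigma_2(v_jv_l)$ if $i=k$. -}

module Defs where

open import Data.Empty using (⊥)
open import Data.Fin using (Fin; zero; suc; combine; remQuot)
import Data.Fin.Properties as Fin
open import Data.Integer using (ℤ; 0ℤ; 1ℤ; -1ℤ; sign; _◃_)
import Data.Integer as ℤ
import Data.Integer.Properties as ℤ
open import Data.Nat using (ℕ; zero; suc; _+_; _*_; _≤_; z≤n; s≤s)
import Data.Nat.Properties as ℕ
open import Data.Product using (Σ; ∃; _×_; _,_; proj₁; proj₂)
open import Data.Product.Function.NonDependent.Propositional using (_×-↔_)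
open import Data.Sign using (Sign)
import Data.Sign as Sign
import Data.Sign.Properties as Sign
open import Data.Sum using (_⊎_; inj₁; inj₂)
open import Data.Vec using (Vec; []; _∷_; lookup; tabulate)
open import Data.Vec.Properties using (lookup∘tabulate)
open import Function using (_∘_; _↔_; Inverse)
open import Function.Construct.Composition using (_↔-∘_)
open import Function.Construct.Identity using (↔-id)
open import Function.Construct.Symmetry using (↔-sym)
open import Function.Properties.Inverse using (↔⇒↣)
open import Relation.Binary using (DecidableEquality)
import Relation.Binary as B
open import Relation.Binary.Construct.Closure.ReflexiveTransitive using (Star)
open import Relation.Binary.PropositionalEquality
  using (_≡_; _≢_; refl; sym; trans; cong; cong₂; subst; subst₂)
open import Relation.Nullary using (¬_; Dec; yes; no; contradiction; ¬?)
open import Relation.Nullary.Decidable using (map′; _×-dec_; _⊎-dec_; via-injection)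
open import Relation.Unary using (Decidable)
open import Algebra.Properties.CommutativeMonoid.Sum ℤ.+-0-commutativeMonoid
  using (sum; sum-cong-≗)

-- Finite simple graphs.  The order |V| comes with an enumeration of V, and
-- adjacency is decidable, as is implicit for a finite graph.

record Graph : Set₁ where
  infix 4 _~_
  field
    V       : Set
    order   : ℕ
    enum    : V ↔ Fin order
    _~_     : V → V → Set
    _~?_    : B.Decidable _~_
    ~-sym   : ∀ {u v} → u ~ v → v ~ u
    ~-irrefl : ∀ {v} → ¬ (v ~ v)

  open Inverse enum public using () renaming (to to index; from to vertex)

  vertex-index : ∀ v → vertex (index v) ≡ v
  vertex-index = Inverse.strictlyInverseʳ enum

  _≟_ : DecidableEquality V
  _≟_ = via-injection (↔⇒↣ enum) Fin._≟_

-- σ takes a proof of adjacency.  σ-edge makes it a function on undirected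
-- edges: it depends neither on the orientation nor (apply it twice) on the
-- proof.

record SignedGraph : Set₁ where
  field
    graph : Graph
  open Graph graph public
  field
    σ      : ∀ {u v} → u ~ v → Sign
    σ-edge : ∀ {u v} (e : u ~ v) (e′ : v ~ u) → σ e ≡ σ e′

  σ-irr : ∀ {u v} (e e′ : u ~ v) → σ e ≡ σ e′
  σ-irr e e′ = trans (σ-edge e (~-sym e)) (σ-edge (~-sym e) e′)

Connected : SignedGraph → Set
Connected S = ∀ u v → Star _~_ u v
  where open SignedGraph S

AllPositive : SignedGraph → Set
AllPositive S = ∀ {u v} (e : u ~ v) → σ e ≡ Sign.+
  where open SignedGraph S

edgeless : ℕ → Graph
edgeless k = record
  { V = Fin k ; order = k ; enum = ↔-id _
  ; _~_ = λ _ _ → ⊥ ; _~?_ = λ _ _ → no λ ()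
  ; ~-sym = λ () ; ~-irrefl = λ ()
  }

N : ℕ → SignedGraph
N k = record { graph = edgeless k ; σ = λ () ; σ-edge = λ () }

lexProduct : Graph → Graph → Graph
lexProduct G H = record
  { V = G.V × H.V
  ; order = G.order * H.order
  ; enum = ↔-sym Fin.*↔× ↔-∘ (G.enum ×-↔ H.enum)
  ; _~_ = λ (u , x) (v , y) → u G.~ v ⊎ (u ≡ v × x H.~ y)
  ; _~?_ = λ (u , x) (v , y) → (u G.~? v) ⊎-dec ((u G.≟ v) ×-dec (x H.~? y))
  ; ~-sym = λ { (inj₁ e) → inj₁ (G.~-sym e)
              ; (inj₂ (p , e)) → inj₂ (sym p , H.~-sym e) }
  ; ~-irrefl = λ { (inj₁ e) → G.~-irrefl e
                 ; (inj₂ (_ , e)) → H.~-irrefl e }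
  }
  where
  module G = Graph G
  module H = Graph H

-- The HG-lexicographic product.  By irreflexivity, an edge of the product is of
-- the form inj₁ exactly when its first coordinates differ.

_[_] : SignedGraph → SignedGraph → SignedGraph
S [ T ] = record
  { graph  = lexProduct S.graph T.graph
  ; σ      = λ { (inj₁ e) → S.σ e ; (inj₂ (_ , e)) → T.σ e }
  ; σ-edge = λ
    { (inj₁ e) (inj₁ e′) → S.σ-edge e e′
    ; (inj₁ e) (inj₂ (refl , _)) → contradiction e S.~-irrefl
    ; (inj₂ (refl , _)) (inj₁ e′) → contradiction e′ S.~-irrefl
    ; (inj₂ (_ , e)) (inj₂ (_ , e′)) → T.σ-edge e e′
    }
  }
  where
  module S = SignedGraph S
  module T = SignedGraph T

infix 20 _[_]

data Ω : Set where
  -𝟏 𝟎 𝟏 : Ω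

⟦_⟧ : Ω → ℤ
⟦ -𝟏 ⟧ = -1ℤ
⟦ 𝟎 ⟧ = 0ℤ
⟦ 𝟏 ⟧ = 1ℤ

-- The standard inner product of ℝᵈ is integer-valued on Ωᵈ.

⟨_,_⟩ : ∀ {d} → Vec Ω d → Vec Ω d → ℤ
⟨ x , y ⟩ = sum λ i → ⟦ lookup x i ⟧ ℤ.* ⟦ lookup y i ⟧

⟨⟩-comm : ∀ {d} (x y : Vec Ω d) → ⟨ x , y ⟩ ≡ ⟨ y , x ⟩
⟨⟩-comm x y = sum-cong-≗ λ i → ℤ.*-comm ⟦ lookup x i ⟧ ⟦ lookup y i ⟧

IsSwitching : (S : SignedGraph) {d : ℕ} → (SignedGraph.V S → Vec Ω d) → Set
IsSwitching S ζ = ∀ {u v} → u ~ v → ⟨ ζ u , ζ v ⟩ ≢ 0ℤ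
  where open SignedGraph S

-- The library's sign sends 0 to +.  This value is never used when ζ is a
-- switching function.

switch : (S : SignedGraph) {d : ℕ} → (SignedGraph.V S → Vec Ω d) → SignedGraph
switch S ζ = record
  { graph  = graph
  ; σ      = λ {u} {v} e → σ e Sign.* sign ⟨ ζ u , ζ v ⟩
  ; σ-edge = λ {u} {v} e e′ →
      cong₂ Sign._*_ (σ-edge e e′) (cong sign (⟨⟩-comm (ζ u) (ζ v)))
  }
  where open SignedGraph S

SwitchesToPositive : (S : SignedGraph) {d : ℕ} → (SignedGraph.V S → Vec Ω d) → Set
SwitchesToPositive S ζ = IsSwitching S ζ × AllPositive (switch S ζ)

BalancedIn : SignedGraph → ℕ → Set
BalancedIn S d = 1 ≤ d × Σ (SignedGraph.V S → Vec Ω d) (SwitchesToPositive S)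

IsLeast : (ℕ → Set) → ℕ → Set
IsLeast P m = P m × (∀ n → P n → m ≤ n)

least : ∀ {P : ℕ → Set} → Decidable P → ∃ P → ∃ (IsLeast P)
least {P} P? (n , p) = go P? n p
  where
  go : ∀ {P : ℕ → Set} → Decidable P → ∀ n → P n → ∃ (IsLeast P)
  go P? zero p = 0 , p , λ _ _ → z≤n
  go {P} P? (suc n) p with P? 0
  ... | yes p₀ = 0 , p₀ , λ _ _ → z≤n
  ... | no ¬p₀ with go (P? ∘ suc) n p
  ...   | m , pm , lb = suc m , pm , λ
          { zero p₀ → contradiction p₀ ¬p₀
          ; (suc j) pj → s≤s (lb j pj) }

-- BalancedIn S is decidable: the maps V → Ωᵈ can be searched exhaustively.

Searchable : Set → Set₁
Searchable A = ∀ {P : A → Set} → Decidable P → Dec (∃ P)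

search-Ω : Searchable Ω
search-Ω P? with P? -𝟏 | P? 𝟎 | P? 𝟏
... | yes p | _     | _     = yes (-𝟏 , p)
... | no _  | yes p | _     = yes (𝟎 , p)
... | no _  | no _  | yes p = yes (𝟏 , p)
... | no a  | no b  | no c  =
  no λ { (-𝟏 , p) → a p ; (𝟎 , p) → b p ; (𝟏 , p) → c p }

search-Vec : ∀ {A} → Searchable A → ∀ n → Searchable (Vec A n)
search-Vec s zero P? = map′ ([] ,_) (λ { ([] , p) → p }) (P? [])
search-Vec s (suc n) P? =
  map′ (λ (x , xs , p) → x ∷ xs , p) (λ { (x ∷ xs , p) → x , xs , p })
       (s λ x → search-Vec s n λ xs → P? (x ∷ xs))

module _ (S : SignedGraph) where
  open SignedGraph S

  all-vertices? : ∀ {P : V → Set} → Decidable P → Dec (∀ v → P v)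
  all-vertices? {P} P? =
    map′ (λ f v → subst P (vertex-index v) (f (index v))) (λ f i → f (vertex i))
         (Fin.all? (P? ∘ vertex))

  EdgeOK : ∀ {d} → (V → Vec Ω d) → V → V → Set
  EdgeOK ζ u v =
    (e : u ~ v) → ⟨ ζ u , ζ v ⟩ ≢ 0ℤ × σ e Sign.* sign ⟨ ζ u , ζ v ⟩ ≡ Sign.+

  edgeOK? : ∀ {d} (ζ : V → Vec Ω d) u v → Dec (EdgeOK ζ u v)
  edgeOK? ζ u v with u ~? v
  ... | no ¬e = yes λ e → contradiction e ¬e
  ... | yes e =
    map′ (λ (p , q) e′ → p , trans (cong (Sign._* _) (σ-irr e′ e)) q) (λ f → f e)
         (¬? (_ ℤ.≟ _) ×-dec (_ Sign.≟ _))

  switchesToPositive? : ∀ {d} → Decidable (SwitchesToPositive S {d})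
  switchesToPositive? ζ =
    map′ (λ f → (λ e → proj₁ (f _ _ e)) , (λ e → proj₂ (f _ _ e)))
         (λ (p , q) _ _ e → p e , q e)
         (all-vertices? λ u → all-vertices? (edgeOK? ζ u))

  SwitchesToPositive-resp : ∀ {d} {ζ η : V → Vec Ω d} → (∀ v → ζ v ≡ η v) →
                            SwitchesToPositive S ζ → SwitchesToPositive S η
  SwitchesToPositive-resp eq (p , q) =
    (λ {u} {v} e → subst₂ (λ x y → ⟨ x , y ⟩ ≢ 0ℤ) (eq u) (eq v) (p e)) ,
    (λ {u} {v} e → subst₂ (λ x y → σ e Sign.* sign ⟨ x , y ⟩ ≡ Sign.+)
                          (eq u) (eq v) (q e))

  balancedIn? : Decidable (BalancedIn S)
  balancedIn? d = (1 ℕ.≤? d) ×-dec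
    map′ (λ (t , p) → lookup t ∘ index , p)
         (λ (ζ , p) → tabulate (ζ ∘ vertex) , SwitchesToPositive-resp
           (λ v → sym (trans (lookup∘tabulate (ζ ∘ vertex) (index v))
                             (cong ζ (vertex-index v)))) p)
         (search-Vec (search-Vec search-Ω d) order
           λ t → switchesToPositive? (lookup t ∘ index))

-- BalancedIn S holds for some d: give each ordered pair (a , b) of vertices a
-- coordinate in which a has entry 1, b has entry σ(ab) (or 0 if a ≁ b), and all
-- other vertices have entry 0.  For an edge uv each term of ⟨ ζ u , ζ v ⟩ is
-- then 0 or σ(uv).  The additional zero coordinate ensures d ≥ 1.

sum-signed : ∀ {n} (s : Sign) (f : Fin n → ℤ) →
             (∀ i → ∃ λ k → f i ≡ s ◃ k) → (∃ λ i → f i ≡ s ◃ 1) →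
             ∃ λ k → sum f ≡ s ◃ suc k
sum-signed s f h (i , p) = go s f h i p
  where
  weak : ∀ {n} s (f : Fin n → ℤ) → (∀ i → ∃ λ k → f i ≡ s ◃ k) →
         ∃ λ k → sum f ≡ s ◃ k
  weak {zero} s f h = 0 , refl
  weak {suc n} s f h with h zero | weak s (f ∘ suc) (h ∘ suc)
  ... | k , p | l , q = k + l , trans (cong₂ ℤ._+_ p q) (sym (ℤ.◃-distrib-+ s k l))

  go : ∀ {n} s (f : Fin n → ℤ) → (∀ i → ∃ λ k → f i ≡ s ◃ k) →
       ∀ i → f i ≡ s ◃ 1 → ∃ λ k → sum f ≡ s ◃ suc k
  go s f h zero p with weak s (f ∘ suc) (h ∘ suc)
  ... | l , q = l , trans (cong₂ ℤ._+_ p q) (sym (ℤ.◃-distrib-+ s 1 l))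
  go s f h (suc i) p with h zero | go s (f ∘ suc) (h ∘ suc) i p
  ... | k , q | l , r = k + l ,
    trans (cong₂ ℤ._+_ q r)
          (trans (sym (ℤ.◃-distrib-+ s k (suc l))) (cong (s ◃_) (ℕ.+-suc k l)))

fromSign : Sign → Ω
fromSign Sign.+ = 𝟏
fromSign Sign.- = -𝟏

⟦fromSign⟧ : ∀ s → ⟦ fromSign s ⟧ ≡ s ◃ 1
⟦fromSign⟧ Sign.+ = refl
⟦fromSign⟧ Sign.- = refl

module _ (S : SignedGraph) where
  open SignedGraph S

  weight : V → V → Ω
  weight a b with a ~? b
  ... | yes e = fromSign (σ e)
  ... | no _  = 𝟎

  weight-edge : ∀ {a b} (e : a ~ b) → ⟦ weight a b ⟧ ≡ σ e ◃ 1
  weight-edge {a} {b} e with a ~? b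
  ... | yes e′ = trans (⟦fromSign⟧ (σ e′)) (cong (_◃ 1) (σ-irr e′ e))
  ... | no ¬e  = contradiction e ¬e

  entry : V → V → V → Ω
  entry a b u with u ≟ a | u ≟ b
  ... | yes _ | _     = 𝟏
  ... | no _  | yes _ = weight a b
  ... | no _  | no _  = 𝟎

  entry-term : ∀ {u v} (e : u ~ v) a b →
               ∃ λ k → ⟦ entry a b u ⟧ ℤ.* ⟦ entry a b v ⟧ ≡ σ e ◃ k
  entry-term {u} {v} e a b with u ≟ a | u ≟ b | v ≟ a | v ≟ b
  ... | yes refl | _        | yes refl | _        = contradiction e ~-irrefl
  ... | yes refl | _        | no _     | yes refl =
    1 , trans (ℤ.*-identityˡ _) (weight-edge e)
  ... | yes refl | _        | no _     | no _     = 0 , refl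
  ... | no _     | yes refl | yes refl | _        =
    1 , trans (ℤ.*-identityʳ _) (trans (weight-edge (~-sym e))
          (cong (_◃ 1) (σ-edge (~-sym e) e)))
  ... | no _     | yes refl | no _     | yes refl = contradiction e ~-irrefl
  ... | no _     | yes refl | no _     | no _     = 0 , ℤ.*-zeroʳ ⟦ weight a b ⟧
  ... | no _     | no _     | _        | _        = 0 , refl

  entry-self : ∀ {u v} (e : u ~ v) →
               ⟦ entry u v u ⟧ ℤ.* ⟦ entry u v v ⟧ ≡ σ e ◃ 1
  entry-self {u} {v} e with u ≟ u | v ≟ u | v ≟ v
  ... | no ¬p | _        | _     = contradiction refl ¬p
  ... | yes _ | yes refl | _     = contradiction e ~-irrefl
  ... | yes _ | no _     | no ¬p = contradiction refl ¬p
  ... | yes _ | no _     | yes _ = trans (ℤ.*-identityˡ _) (weight-edge e)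

  private
    coord : V → Fin (order * order) → Ω
    coord u c = entry (vertex (proj₁ (remQuot order c)))
                      (vertex (proj₂ (remQuot {order} order c))) u

    ζ₀ : V → Vec Ω (suc (order * order))
    ζ₀ u = 𝟎 ∷ tabulate (coord u)

    term-≡ : ∀ u v c → ⟦ lookup (tabulate (coord u)) c ⟧ ℤ.* ⟦ lookup (tabulate (coord v)) c ⟧
                     ≡ ⟦ coord u c ⟧ ℤ.* ⟦ coord v c ⟧
    term-≡ u v c = cong₂ (λ x y → ⟦ x ⟧ ℤ.* ⟦ y ⟧)
                         (lookup∘tabulate (coord u) c) (lookup∘tabulate (coord v) c)

    coord-combine : ∀ a b u → coord u (combine (index a) (index b)) ≡ entry a b u
    coord-combine a b u = trans
      (cong (λ (i , j) → entry (vertex i) (vertex j) u)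
            (Fin.remQuot-combine (index a) (index b)))
      (cong₂ (λ x y → entry x y u) (vertex-index a) (vertex-index b))

    inner-ζ₀ : ∀ {u v} (e : u ~ v) → ∃ λ k → ⟨ ζ₀ u , ζ₀ v ⟩ ≡ σ e ◃ suc k
    inner-ζ₀ {u} {v} e = sum-signed (σ e)
      (λ i → ⟦ lookup (ζ₀ u) i ⟧ ℤ.* ⟦ lookup (ζ₀ v) i ⟧)
      (λ { zero → 0 , refl
         ; (suc c) → let k , p = entry-term e _ _ in k , trans (term-≡ u v c) p })
      (suc (combine (index u) (index v)) ,
       trans (term-≡ u v _)
         (trans (cong₂ (λ x y → ⟦ x ⟧ ℤ.* ⟦ y ⟧) (coord-combine u v u) (coord-combine u v v))
                (entry-self e)))

    ◃-suc-≢0 : ∀ s k → s ◃ suc k ≢ 0ℤ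
    ◃-suc-≢0 Sign.+ k ()
    ◃-suc-≢0 Sign.- k ()

  balancedIn-some : ∃ (BalancedIn S)
  balancedIn-some = suc (order * order) , s≤s z≤n , ζ₀ ,
    (λ e p → let k , q = inner-ζ₀ e in ◃-suc-≢0 (σ e) k (trans (sym q) p)) ,
    (λ e → let k , q = inner-ζ₀ e in
      trans (cong (λ z → σ e Sign.* sign z) q)
        (trans (cong (σ e Sign.*_) (ℤ.sign-◃ (σ e) (suc k))) (Sign.s*s≡+ (σ e))))

bdim : SignedGraph → ℕ
bdim S = proj₁ (least (balancedIn? S) (balancedIn-some S))

bdim-isLeast : ∀ S → IsLeast (BalancedIn S) (bdim S)
bdim-isLeast S = proj₂ (least (balancedIn? S) (balancedIn-some S))

{-# OPTIONS --safe #-}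

-- A switching to all-positive pulls back along any sign-preserving graph
-- homomorphism, so bdim is monotone along homomorphisms.  Both products retract
-- onto Σ: project to Σ and, since k ≥ 1, embed Σ as the copy over a vertex of N_k.

module Submission where

open import Defs
open import Data.Fin using (zero)
open import Data.Nat using (ℕ; _≤_; s≤s)
open import Data.Nat.Properties using (≤-antisym)
open import Data.Product using (_×_; _,_; proj₁; proj₂)
import Data.Sign as Sign
open import Data.Sum using (inj₁; inj₂)
open import Function using (_∘_)
open import Relation.Binary.PropositionalEquality using (_≡_; refl; sym; trans; cong)

record Hom (S T : SignedGraph) : Set where
  private
    module S = SignedGraph S
    module T = SignedGraph T
  field
    map      : S.V → T.V
    map-edge : ∀ {u v} → u S.~ v → map u T.~ map v
    map-σ    : ∀ {u v} (e : u S.~ v) → T.σ (map-edge e) ≡ S.σ e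

-- Along `e`, `ζ ∘ map` has the very inner product that `ζ` has along `map-edge e`, so only the
-- original sign must be exchanged, by `map-σ`.
BalancedIn-pullback : ∀ {S T} → Hom S T → ∀ {d} → BalancedIn T d → BalancedIn S d
BalancedIn-pullback h (1≤d , ζ , switching , positive) =
  1≤d , ζ ∘ map , switching ∘ map-edge ,
  λ e → trans (cong (Sign._* _) (sym (map-σ e))) (positive (map-edge e))
  where open Hom h

bdim-mono : ∀ S T → Hom S T → bdim S ≤ bdim T
bdim-mono S T h =
  proj₂ (bdim-isLeast S) (bdim T) (BalancedIn-pullback h (proj₁ (bdim-isLeast T)))

bdim-cong : ∀ S T → Hom S T → Hom T S → bdim S ≡ bdim T
bdim-cong S T f g = ≤-antisym (bdim-mono S T f) (bdim-mono T S g)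

-- The product is `k` disjoint copies of `S`, and folding them onto one preserves edges and signs.
bdim-N[S] : ∀ S {k} → 1 ≤ k → bdim (N k [ S ]) ≡ bdim S
bdim-N[S] S {k} (s≤s _) = bdim-cong (N k [ S ]) S
  (record { map = proj₂ ; map-edge = λ { (inj₂ (_ , e)) → e } ; map-σ = λ { (inj₂ _) → refl } })
  -- `zero : Fin k` is available because matching `1 ≤ k` with `s≤s` makes `k` a successor.
  (record { map = zero ,_ ; map-edge = λ e → inj₂ (refl , e) ; map-σ = λ _ → refl })

-- Each vertex of `S` becomes `k` pairwise nonadjacent twins, which can share one vector: every edge
-- lies over an edge of `S` with the same sign.
bdim-S[N] : ∀ S {k} → 1 ≤ k → bdim (S [ N k ]) ≡ bdim S
bdim-S[N] S {k} (s≤s _) = bdim-cong (S [ N k ]) S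
  (record { map = proj₁ ; map-edge = λ { (inj₁ e) → e } ; map-σ = λ { (inj₁ _) → refl } })
  (record { map = _, zero ; map-edge = inj₁ ; map-σ = λ _ → refl })

proposition2p12 : (S : SignedGraph) → Connected S → (k : ℕ) → 1 ≤ k →
    (bdim (N k [ S ]) ≡ bdim (S [ N k ])) × (bdim (S [ N k ]) ≡ bdim S)
proposition2p12 S _ k 1≤k =
  trans (bdim-N[S] S 1≤k) (sym (bdim-S[N] S 1≤k)) , bdim-S[N] S 1≤k
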